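{- Let $M$ be a connected matroid, let $N$ be a binary matroid, and let $f: M \rightarrow N$ be a matroid homomorphism. Then either, for every $x \in E(N)$, the set $f^{ -1}(x)$ is a series class of $M$, or $N$ is a circuit (that is, $E(N) \in \mathcal{C}(N)$).
   Context: For a matroid $X$, $E(X)$ denotes its ground set and $\mathcal{C}(X)$ its set of circuits. A matroid homomorphism $f: M \rightarrow N$ is a map $f: E(M) \rightarrow E(N)$ from the ground set of $M$ onto the ground set of $N$ such that $f(C) \in \mathcal{C}(N)$ for every $C \in \mathcal{C}(M)$. A set $S \subseteq E(M)$ is called a series class of $M$ if its elements are pairwise in series, i.e., every circuit of $M$ that meets $S$ contains $S$ (equivalently, there are no $x_1, x_2 \in S$ and $A \in \mathcal{C}(M)$ with $x_1 \in A$, $x_2 \notin A$). -}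

module Defs where

open import Level using (Level; _⊔_) renaming (suc to lsuc)
open import Data.Nat using (ℕ)
open import Data.Bool using (Bool; true; false; _xor_; _∧_)
open import Data.Fin using (Fin; zero; suc; _≟_)
open import Data.Fin.Subset using (Subset; _∈_; _∉_; _⊆_; _∪_; ⊥; ⊤; ⁅_⁆; _─_; Nonempty)
open import Data.Fin.Subset.Properties using (_∈?_)
open import Data.Fin.Properties using (any?)
open import Data.Vec using (tabulate; lookup)
open import Data.Product using (Σ; ∃; ∃-syntax; _×_; _,_)
open import Relation.Binary.PropositionalEquality using (_≡_)
open import Relation.Nullary using (¬_; ⌊_⌋)
open import Relation.Nullary.Decidable using (_×-dec_)
open import Function using (Surjective; _⇔_)

-- A (finite) matroid on the ground set Fin size, given by its circuits
-- (circuit axioms (C1)-(C3) of Oxley).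
record Matroid (ℓ : Level) : Set (lsuc ℓ) where
  field
    size     : ℕ
    Circuit  : Subset size → Set ℓ
    C1       : ¬ Circuit ⊥
    C2       : ∀ {C D} → Circuit C → Circuit D → C ⊆ D → C ≡ D
    C3       : ∀ {C D} e → Circuit C → Circuit D → ¬ (C ≡ D) →
               e ∈ C → e ∈ D →
               ∃[ F ] (Circuit F × F ⊆ ((C ∪ D) ─ ⁅ e ⁆))

open Matroid public

E : ∀ {ℓ} → Matroid ℓ → Set
E M = Fin (size M)

Connected : ∀ {ℓ} → Matroid ℓ → Set ℓ
Connected M = ∀ (x y : E M) → ¬ (x ≡ y) → ∃[ C ] (Circuit M C × x ∈ C × y ∈ C)

image : ∀ {n k} → (Fin n → Fin k) → Subset n → Subset k
image f C = tabulate (λ x → ⌊ any? (λ y → (y ∈? C) ×-dec (f y ≟ x)) ⌋)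

preimage : ∀ {n k} → (Fin n → Fin k) → Fin k → Subset n
preimage f x = tabulate (λ y → ⌊ f y ≟ x ⌋)

IsHom : ∀ {ℓ ℓ'} (M : Matroid ℓ) (N : Matroid ℓ') → (E M → E N) → Set (ℓ ⊔ ℓ')
IsHom M N f = Surjective _≡_ _≡_ f × (∀ C → Circuit M C → Circuit N (image f C))

IsSeriesClass : ∀ {ℓ} (M : Matroid ℓ) → Subset (size M) → Set ℓ
IsSeriesClass M S = ∀ x₁ x₂ A → x₁ ∈ S → x₂ ∈ S → Circuit M A → x₁ ∈ A → x₂ ∈ A

xorSum : ∀ {n} → (Fin n → Bool) → Bool
xorSum {ℕ.zero}  g = false
xorSum {ℕ.suc n} g = g zero xor xorSum (λ j → g (suc j))

ZeroSum : ∀ {m n} → (Fin m → Fin n → Bool) → Subset n → Set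
ZeroSum A C = ∀ i → xorSum (λ j → lookup C j ∧ A i j) ≡ false

-- C is a circuit of the vector matroid M[A] over GF(2): a minimal
-- linearly dependent set of columns, i.e. a minimal nonempty set of
-- columns summing to zero.
VecCircuit : ∀ {m n} → (Fin m → Fin n → Bool) → Subset n → Set
VecCircuit A C = Nonempty C × ZeroSum A C ×
                 (∀ D → D ⊆ C → Nonempty D → ZeroSum A D → D ≡ C)

Binary : ∀ {ℓ} → Matroid ℓ → Set ℓ
Binary N = ∃[ m ] Σ (Fin m → Fin (size N) → Bool) λ A →
           ∀ C → (Circuit N C ⇔ VecCircuit A C)

{-# OPTIONS --safe #-}

-- Suppose a circuit A of M contains a but not b, where f a ≡ f b, and put
-- T = f(A).  For a circuit C meeting A with C ∖ A minimal, elimination yields a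
-- second circuit F with the same ear F ∖ A = C ∖ A and A ⊆ C ∪ F.  In the binary
-- matroid N the sum f(C) + f(F) is a cycle inside the circuit T, so it is ∅ or T.
-- Hence an ear that leaves f⁻¹(T) misses it altogether, and then f(C ∩ A) and
-- f(F ∩ A) partition T.  An ear through b therefore maps into T, which gives a
-- circuit B ≠ A with f(B) = T.  If some element of N lay outside T, a minimal ear
-- S over A and B leaving f⁻¹(T) would split both circuits compatibly,
-- A = W ∪ W′ and B = V ∪ V′ with f(W) = f(V) and f(W′) = f(V′); eliminating
-- an element of S from S ∪ W and S ∪ V contradicts the minimality of S unless
-- W = V, and likewise W′ = V′, so that A = B.  Hence T = E(N).
module Submission where

open import Defs
open import Level using (Level)
open import Algebra.Bundles using (CommutativeMonoid; CommutativeRing)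
import Algebra.Properties.CommutativeSemigroup as CommutativeSemigroupProperties
open import Data.Bool using (Bool; true; false; _xor_; _∧_)
open import Data.Bool.Properties using (xor-comm; ∧-distribʳ-xor; xor-∧-commutativeRing) renaming (_≟_ to _≟ᵇ_)
open import Data.Fin using (Fin; zero; suc; _≟_)
open import Data.Fin.Properties using (any?; all?)
open import Data.Fin.Subset using (Subset; _∈_; _∉_; _⊆_; _⊈_; _⊂_; _∪_; _-_; ⁅_⁆; ⊤)
open import Data.Fin.Subset.Induction using (Acc; acc; ⊂-wellFounded)
open import Data.Fin.Subset.Properties using (_∈?_; _⊆?_; nonempty?; anySubset?; ⊆-antisym; ⊆⊤; ∈⊤; x∈p∪q⁺; x∈p∪q⁻; p─q⊆p; x∈p∧x≢y⇒x∈p-y; x∈p⇒p-x⊂p)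
open import Data.Nat using (ℕ)
open import Data.Product using (∃; ∃-syntax; _×_; _,_; proj₁; proj₂)
open import Data.Sum using (_⊎_; inj₁; inj₂; [_,_]′; swap)
open import Data.Vec using ([]; _∷_; here; there; lookup; tabulate; zipWith)
open import Data.Vec.Properties using ([]=⇒lookup; lookup⇒[]=; lookup∘tabulate; lookup-zipWith; ≡-dec)
open import Function using (_∘_; _⇔_; mk⇔)
open import Function.Bundles using (Equivalence)
open import Relation.Binary.PropositionalEquality using (_≡_; _≢_; refl; sym; trans; cong; cong₂; subst; module ≡-Reasoning)
open import Relation.Nullary using (¬_; Dec; yes; no; contradiction; ⌊_⌋)
open import Relation.Nullary.Decidable using (_×-dec_; ¬?; map; decidable-stable; dec-true; isYes≗does)

open Equivalence using (to; from)
open CommutativeSemigroupProperties (CommutativeMonoid.commutativeSemigroup (CommutativeRing.+-commutativeMonoid xor-∧-commutativeRing)) using (interchange)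

private
  variable
    ℓ ℓ' : Level
    m n : ℕ

-- Finite subsets

⊈⇒∃∉ : {p q : Subset n} → p ⊈ q → ∃[ x ] (x ∈ p × x ∉ q)
⊈⇒∃∉ {p = p} {q} p⊈q with any? (λ x → (x ∈? p) ×-dec ¬? (x ∈? q))
... | yes w = w
... | no ¬w = contradiction (λ {x} x∈p → decidable-stable (x ∈? q) λ x∉q → ¬w (x , x∈p , x∉q)) p⊈q

∉⇒≢ : {p q : Subset n} {x : Fin n} → x ∈ p → x ∉ q → p ≢ q
∉⇒≢ x∈p x∉q refl = x∉q x∈p

x∉p-x : (p : Subset n) (x : Fin n) → x ∉ p - x
x∉p-x (true  ∷ p) zero ()
x∉p-x (false ∷ p) zero ()
x∉p-x (_ ∷ p) (suc x) (there x∈) = x∉p-x p x x∈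

∈tabulate⁺ : {P : Fin n → Set} (P? : ∀ x → Dec (P x)) {x : Fin n} → P x → x ∈ tabulate (λ x → ⌊ P? x ⌋)
∈tabulate⁺ P? {x} px = lookup⇒[]= x _ (trans (lookup∘tabulate _ x) (trans (isYes≗does (P? x)) (dec-true (P? x) px)))

∈tabulate⁻ : {P : Fin n → Set} (P? : ∀ x → Dec (P x)) {x : Fin n} → x ∈ tabulate (λ x → ⌊ P? x ⌋) → P x
∈tabulate⁻ P? {x} x∈ with P? x | trans (sym (lookup∘tabulate (λ x → ⌊ P? x ⌋) x)) ([]=⇒lookup x∈)
... | yes px | _ = px

module _ (f : Fin n → Fin m) where

  ∈image⁺ : {C : Subset n} {x : Fin n} → x ∈ C → f x ∈ image f C
  ∈image⁺ {C} {x} x∈C = ∈tabulate⁺ (λ x → any? (λ y → (y ∈? C) ×-dec (f y ≟ x))) (x , x∈C , refl)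

  ∈image⁻ : {C : Subset n} {y : Fin m} → y ∈ image f C → ∃[ x ] (x ∈ C × f x ≡ y)
  ∈image⁻ {C} = ∈tabulate⁻ (λ x → any? (λ y → (y ∈? C) ×-dec (f y ≟ x)))

  ∈preimage⁻ : {x : Fin n} {y : Fin m} → x ∈ preimage f y → f x ≡ y
  ∈preimage⁻ {y = y} = ∈tabulate⁻ (λ x → f x ≟ y)

-- Binary matroids

xorSum-cong : {g h : Fin n → Bool} → (∀ i → g i ≡ h i) → xorSum g ≡ xorSum h
xorSum-cong {ℕ.zero}  g≗h = refl
xorSum-cong {ℕ.suc n} g≗h = cong₂ _xor_ (g≗h zero) (xorSum-cong (g≗h ∘ suc))

xorSum-xor : (g h : Fin n → Bool) → xorSum (λ i → g i xor h i) ≡ xorSum g xor xorSum h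
xorSum-xor {ℕ.zero}  g h = refl
xorSum-xor {ℕ.suc n} g h = trans (cong ((g zero xor h zero) xor_) (xorSum-xor (g ∘ suc) (h ∘ suc))) (interchange (g zero) (h zero) _ _)

infixl 6 _△_
_△_ : Subset n → Subset n → Subset n
_△_ = zipWith _xor_

ZeroSum-△ : (A : Fin m → Fin n → Bool) {C D : Subset n} → ZeroSum A C → ZeroSum A D → ZeroSum A (C △ D)
ZeroSum-△ A {C} {D} zC zD i = begin
  xorSum (λ j → lookup (C △ D) j ∧ A i j)
    ≡⟨ xorSum-cong (λ j → trans (cong (_∧ A i j) (lookup-zipWith _xor_ j C D)) (∧-distribʳ-xor (A i j) (lookup C j) (lookup D j))) ⟩
  xorSum (λ j → (lookup C j ∧ A i j) xor (lookup D j ∧ A i j))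
    ≡⟨ xorSum-xor (λ j → lookup C j ∧ A i j) (λ j → lookup D j ∧ A i j) ⟩
  xorSum (λ j → lookup C j ∧ A i j) xor xorSum (λ j → lookup D j ∧ A i j)
    ≡⟨ cong₂ _xor_ (zC i) (zD i) ⟩
  false ∎
  where open ≡-Reasoning

∈△⁻ : (p q : Subset n) {x : Fin n} → x ∈ p △ q → (x ∈ p × x ∉ q) ⊎ (x ∉ p × x ∈ q)
∈△⁻ (true  ∷ p) (false ∷ q) here = inj₁ (here , λ ())
∈△⁻ (false ∷ p) (true  ∷ q) here = inj₂ ((λ ()) , here)
∈△⁻ (_ ∷ p) (_ ∷ q) (there x∈) with ∈△⁻ p q x∈
... | inj₁ (x∈p , x∉q) = inj₁ (there x∈p , λ { (there x∈q) → x∉q x∈q })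
... | inj₂ (x∉p , x∈q) = inj₂ ((λ { (there x∈p) → x∉p x∈p }) , there x∈q)

∈△⁺ : (p q : Subset n) {x : Fin n} → x ∈ p → x ∉ q → x ∈ p △ q
∈△⁺ (_ ∷ p) (false ∷ q) here x∉q = here
∈△⁺ (_ ∷ p) (true  ∷ q) here x∉q = contradiction here x∉q
∈△⁺ (_ ∷ p) (_ ∷ q) (there x∈p) x∉q = there (∈△⁺ p q x∈p (x∉q ∘ there))

△-comm : (p q : Subset n) → p △ q ≡ q △ p
△-comm []      []      = refl
△-comm (a ∷ p) (b ∷ q) = cong₂ _∷_ (xor-comm a b) (△-comm p q)

-- The sum of two circuits is a zero-sum set of columns; lying inside `T`, it is empty or, by
-- minimality of `T`, all of `T`.
binary-△-⊆ : (N : Matroid ℓ) → Binary N → ∀ {U V T} →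
             Circuit N U → Circuit N V → Circuit N T →
             (∀ {y} → y ∈ U → y ∉ V → y ∈ T) → (∀ {y} → y ∈ V → y ∉ U → y ∈ T) →
             U ≡ V ⊎ (∀ {y} → y ∈ T → (y ∈ U × y ∉ V) ⊎ (y ∉ U × y ∈ V))
binary-△-⊆ N (_ , A , iff) {U} {V} {T} cU cV cT U─V⊆T V─U⊆T with nonempty? (U △ V)
... | yes ne = inj₂ λ y∈T → ∈△⁻ U V (subst (_ ∈_) (sym U△V≡T) y∈T)
  where
  U△V⊆T : U △ V ⊆ T
  U△V⊆T y∈ with ∈△⁻ U V y∈
  ... | inj₁ (y∈U , y∉V) = U─V⊆T y∈U y∉V
  ... | inj₂ (y∉U , y∈V) = V─U⊆T y∈V y∉U
  U△V≡T : U △ V ≡ T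
  U△V≡T = proj₂ (proj₂ (to (iff T) cT)) (U △ V) U△V⊆T ne
            (ZeroSum-△ A {U} {V} (proj₁ (proj₂ (to (iff U) cU))) (proj₁ (proj₂ (to (iff V) cV))))
... | no ¬ne = inj₁ (⊆-antisym
  (λ {x} x∈U → decidable-stable (x ∈? V) λ x∉V → ¬ne (x , ∈△⁺ U V x∈U x∉V))
  (λ {x} x∈V → decidable-stable (x ∈? U) λ x∉U → ¬ne (x , subst (x ∈_) (△-comm V U) (∈△⁺ V U x∈V x∉U))))

VecCircuit? : (A : Fin m → Fin n → Bool) (C : Subset n) → Dec (VecCircuit A C)
VecCircuit? A C = nonempty? C ×-dec (zeroSum? C ×-dec map (mk⇔ ¬∃⇒min min⇒¬∃) (¬? (anySubset? bad?)))
  where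
  zeroSum? : ∀ D → Dec (ZeroSum A D)
  zeroSum? D = all? (λ i → _ ≟ᵇ false)
  Bad : Subset _ → Set
  Bad D = D ⊆ C × ∃ (_∈ D) × ZeroSum A D × D ≢ C
  bad? : ∀ D → Dec (Bad D)
  bad? D = (D ⊆? C) ×-dec (nonempty? D ×-dec (zeroSum? D ×-dec ¬? (≡-dec _≟ᵇ_ D C)))
  ¬∃⇒min : ¬ ∃ Bad → ∀ D → D ⊆ C → ∃ (_∈ D) → ZeroSum A D → D ≡ C
  ¬∃⇒min ¬bad D D⊆C ne z = decidable-stable (≡-dec _≟ᵇ_ D C) λ D≢C → ¬bad (D , D⊆C , ne , z , D≢C)
  min⇒¬∃ : (∀ D → D ⊆ C → ∃ (_∈ D) → ZeroSum A D → D ≡ C) → ¬ ∃ Bad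
  min⇒¬∃ minC (D , D⊆C , ne , z , D≢C) = D≢C (minC D D⊆C ne z)

-- `Circuit N` is an arbitrary predicate; a representation makes it decidable, which lets the
-- theorem choose between its two alternatives.
binary⇒circuit? : (N : Matroid ℓ) → Binary N → ∀ C → Dec (Circuit N C)
binary⇒circuit? N (_ , A , iff) C = map (mk⇔ (from (iff C)) (to (iff C))) (VecCircuit? A C)

-- Circuit elimination and minimal ears

⊆-remove : {p r : Subset n} {x : Fin n} → p ⊆ r → x ∉ p → p ⊆ r - x
⊆-remove p⊆r x∉p y∈p = x∈p∧x≢y⇒x∈p-y (p⊆r y∈p) λ { refl → x∉p y∈p }

∪-lub : {p q r : Subset n} → p ⊆ r → q ⊆ r → p ∪ q ⊆ r
∪-lub p⊆r q⊆r = [ p⊆r , q⊆r ]′ ∘ x∈p∪q⁻ _ _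

∉∪ : {p q : Subset n} {x : Fin n} → x ∉ p → x ∉ q → x ∉ p ∪ q
∉∪ x∉p x∉q = [ x∉p , x∉q ]′ ∘ x∈p∪q⁻ _ _

∈∪∖ˡ : {p q : Subset n} {x : Fin n} → x ∈ p ∪ q → x ∉ p → x ∈ q
∈∪∖ˡ x∈ x∉p = [ (λ x∈p → contradiction x∈p x∉p) , (λ x∈q → x∈q) ]′ (x∈p∪q⁻ _ _ x∈)

module _ (M : Matroid ℓ) where

  elimination : ∀ {C D e} → Circuit M C → Circuit M D → C ≢ D → e ∈ C → e ∈ D →
                ∃[ F ] (Circuit M F × F ⊆ C ∪ D × e ∉ F)
  elimination {C} {D} {e} cC cD C≢D e∈C e∈D with C3 M e cC cD C≢D e∈C e∈D
  ... | F , cF , F⊆ = F , cF , p─q⊆p (C ∪ D) ⁅ e ⁆ ∘ F⊆ , x∉p-x (C ∪ D) e ∘ F⊆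

  circuit-∖ : ∀ {C D x} → Circuit M C → Circuit M D → x ∈ D → x ∉ C → ∃[ y ] (y ∈ C × y ∉ D)
  circuit-∖ cC cD x∈D x∉C = ⊈⇒∃∉ λ C⊆D → ∉⇒≢ x∈D x∉C (sym (C2 M cC cD C⊆D))

  -- Induction on a set `R` containing both circuits. If eliminating `e` yields an `F` without `g`,
  -- take `h` in `F` outside `C`. Within `R - g`, eliminate `h` from `D` and `F` keeping `e`. The
  -- result `G` avoids both `g` and `h`, so within `R - h` one can eliminate `e` from `C` and `G`
  -- keeping `g`.
  strong-elimination : ∀ {C D R e g} → Acc _⊂_ R → C ⊆ R → D ⊆ R →
                       Circuit M C → Circuit M D → e ∈ C → e ∈ D → g ∈ C → g ∉ D →
                       ∃[ F ] (Circuit M F × g ∈ F × F ⊆ C ∪ D × e ∉ F)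
  strong-elimination {C} {D} {R} {e} {g} (acc rec) C⊆R D⊆R cC cD e∈C e∈D g∈C g∉D
    with elimination cC cD (∉⇒≢ g∈C g∉D) e∈C e∈D
  ... | F , cF , F⊆ , e∉F with g ∈? F
  ... | yes g∈F = F , cF , g∈F , F⊆ , e∉F
  ... | no g∉F with circuit-∖ cF cC e∈C e∉F
  ... | h , h∈F , h∉C
    with strong-elimination (rec (x∈p⇒p-x⊂p (C⊆R g∈C)))
           (⊆-remove D⊆R g∉D) (⊆-remove (∪-lub C⊆R D⊆R ∘ F⊆) g∉F)
           cD cF (∈∪∖ˡ (F⊆ h∈F) h∉C) h∈F e∈D e∉F
  ... | G , cG , e∈G , G⊆ , h∉G
    with strong-elimination (rec (x∈p⇒p-x⊂p (∪-lub C⊆R D⊆R (F⊆ h∈F))))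
           (⊆-remove C⊆R h∉C) (⊆-remove (∪-lub D⊆R (∪-lub C⊆R D⊆R ∘ F⊆) ∘ G⊆) h∉G)
           cC cG e∈C e∈G g∈C (∉∪ g∉D g∉F ∘ G⊆)
  ... | H , cH , g∈H , H⊆ , e∉H =
    H , cH , g∈H , ∪-lub (x∈p∪q⁺ ∘ inj₁) (∪-lub (x∈p∪q⁺ ∘ inj₂) F⊆ ∘ G⊆) ∘ H⊆ , e∉H

  -- When `C` is not contained in `A`, `minimal` makes the part of `C` outside `A` a circuit of the
  -- contraction of `M` by `A`.
  record MinimalEar (A C : Subset (size M)) : Set ℓ where
    field
      circuit : Circuit M C
      meets   : ∃[ x ] (x ∈ C × x ∈ A)
      minimal : ∀ {F x s} → Circuit M F → F ⊆ A ∪ C → x ∈ F → x ∉ A → s ∈ C → s ∉ A → s ∈ F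

  -- Only the double negation is available: Circuit M need not be decidable.
  minimalEar : ∀ {A C R e} → Acc _⊂_ R → (∀ {x} → x ∈ C → x ∉ A → x ∈ R) →
               Circuit M C → ∃[ x ] (x ∈ C × x ∈ A) → e ∈ C → e ∉ A →
               ¬ ¬ (∃[ D ] (MinimalEar A D × e ∈ D × D ⊆ A ∪ C))
  minimalEar {A} {C} {R} {e} (acc rec) C⊆R cC C∩A e∈C e∉A k = k (C , ear , e∈C , x∈p∪q⁺ ∘ inj₂)
    where
    -- A circuit through `e` that misses a point `t` of the ear has a smaller, still nonempty ear,
    -- so the induction applies with `R - t`.
    shrink : ∀ {G t} → Circuit M G → G ⊆ A ∪ C → e ∈ G → t ∈ C → t ∉ A → ¬ (t ∉ G)
    shrink {G} {t} cG G⊆ e∈G t∈C t∉A t∉G =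
      minimalEar (rec (x∈p⇒p-x⊂p (C⊆R t∈C t∉A)))
        (λ x∈G x∉A → x∈p∧x≢y⇒x∈p-y (C⊆R (∈∪∖ˡ (G⊆ x∈G) x∉A) x∉A) λ { refl → t∉G x∈G })
        cG G∩A e∈G e∉A
        λ (D , earD , e∈D , D⊆) → k (D , earD , e∈D , ∪-lub (x∈p∪q⁺ ∘ inj₁) G⊆ ∘ D⊆)
      where
      G∩A : ∃[ x ] (x ∈ G × x ∈ A)
      G∩A with circuit-∖ cG cC t∈C t∉G
      ... | y , y∈G , y∉C = y , y∈G , [ (λ y∈A → y∈A) , (λ y∈C → contradiction y∈C y∉C) ]′ (x∈p∪q⁻ _ _ (G⊆ y∈G))

    ear : MinimalEar A C
    ear .MinimalEar.circuit = cC
    ear .MinimalEar.meets = C∩A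
    ear .MinimalEar.minimal {F} {x} {s} cF F⊆ x∈F x∉A s∈C s∉A = decidable-stable (s ∈? F) s∉F⇒⊥
      where
      s∉F⇒⊥ : ¬ (s ∉ F)
      s∉F⇒⊥ with e ∈? F
      ... | yes e∈F = shrink cF F⊆ e∈F s∈C s∉A
      -- `F` misses `e` and cannot continue the descent itself; eliminating `x` from `C` and `F`
      -- while keeping `e` gives a circuit that can, since it lacks the ear point `x`.
      ... | no e∉F with strong-elimination (⊂-wellFounded ⊤) ⊆⊤ ⊆⊤ cC cF (∈∪∖ˡ (F⊆ x∈F) x∉A) x∈F e∈C e∉F
      ... | G , cG , e∈G , G⊆ , x∉G = λ _ →
        shrink cG (∪-lub (x∈p∪q⁺ ∘ inj₂) F⊆ ∘ G⊆) e∈G (∈∪∖ˡ (F⊆ x∈F) x∉A) x∉A x∉G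

-- Homomorphisms into a binary matroid

module _ (M : Matroid ℓ) (N : Matroid ℓ') (f : E M → E N) (binary : Binary N)
         (hom : ∀ C → Circuit M C → Circuit N (image f C)) where

  image≡ : ∀ {C T} → Circuit M C → Circuit N T → (∀ {x} → x ∈ C → f x ∈ T) → image f C ≡ T
  image≡ cC cT C⊆ = C2 N (hom _ cC) cT λ y∈ → case∈ (∈image⁻ f y∈)
    where
    case∈ : ∀ {y} → ∃[ x ] (x ∈ _ × f x ≡ y) → y ∈ _
    case∈ (x , x∈C , refl) = C⊆ x∈C

  -- A together with an ear whose ends split A into the parts A ∩ X and A ∩ Y;
  -- T is the image of A.
  record Theta (T : Subset (size N)) (A X Y : Subset (size M)) : Set ℓ where
    field
      circuitˣ  : Circuit M X
      circuitʸ  : Circuit M Y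
      insideˣ   : ∀ {x} → x ∈ X → f x ∈ T → x ∈ A
      insideʸ   : ∀ {x} → x ∈ Y → f x ∈ T → x ∈ A
      ear       : ∀ {x} → f x ∉ T → x ∈ X ⇔ x ∈ Y
      cover     : A ⊆ X ∪ Y
      separated : ∀ {x y} → x ∈ X → y ∈ Y → f x ∈ T → f x ≢ f y
      meetsˣ    : ∃[ x ] (x ∈ X × f x ∈ T)
      meetsʸ    : ∃[ y ] (y ∈ Y × f y ∈ T)
      leaves    : ∃[ e ] (e ∈ X × f e ∉ T)

  open Theta

  Theta-swap : ∀ {T A X Y} → Theta T A X Y → Theta T A Y X
  Theta-swap θ = record
    { circuitˣ = circuitʸ θ ; circuitʸ = circuitˣ θ
    ; insideˣ = insideʸ θ ; insideʸ = insideˣ θ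
    ; ear = λ x∉ → mk⇔ (from (ear θ x∉)) (to (ear θ x∉))
    ; cover = x∈p∪q⁺ ∘ swap ∘ x∈p∪q⁻ _ _ ∘ cover θ
    ; separated = λ x∈Y y∈X x∈T fx≡fy → separated θ y∈X x∈Y (subst (_∈ _) fx≡fy x∈T) (sym fx≡fy)
    ; meetsˣ = meetsʸ θ ; meetsʸ = meetsˣ θ
    ; leaves = let (e , e∈X , e∉T) = leaves θ in e , to (ear θ e∉T) e∈X , e∉T
    }

  separated-image : ∀ {T A X Y y} → Theta T A X Y → y ∈ Y → f y ∈ T → f y ∉ image f X
  separated-image θ y∈Y fy∈T fy∈fX with ∈image⁻ f fy∈fX
  ... | x , x∈X , fx≡fy = separated θ x∈X y∈Y (subst (_∈ _) (sym fx≡fy) fy∈T) fx≡fy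

  -- The second strand `Y` comes from eliminating a common point of `A` and `X`. By minimality it
  -- has the same ear as `X`, so the two images differ only within `T`, where the binary structure
  -- of `N` separates them.
  minimalEar⇒theta : ∀ {A X e} → Circuit M A → MinimalEar M A X → e ∈ X → f e ∉ image f A →
                     ∃[ Y ] Theta (image f A) A X Y
  minimalEar⇒theta {A} {X} {e} cA earX e∈X fe∉T = Y , record
    { circuitˣ = cX ; circuitʸ = cY
    ; insideˣ = inˣ
    ; insideʸ = λ {y} y∈Y fy∈T → decidable-stable (y ∈? A) λ y∉A → y∉A (inˣ (∈∪∖ˡ (Y⊆ y∈Y) y∉A) fy∈T)
    ; ear = λ x∉T → mk⇔ (λ x∈X → X∖A⊆Y x∈X (x∉T ∘ ∈image⁺ f)) (λ x∈Y → ∈∪∖ˡ (Y⊆ x∈Y) (x∉T ∘ ∈image⁺ f))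
    ; cover = A⊆X∪Y
    ; separated = λ x∈X y∈Y fx∈T fx≡fy → not-both fx∈T (∈image⁺ f x∈X) (subst (_∈ image f Y) (sym fx≡fy) (∈image⁺ f y∈Y))
    ; meetsˣ = w , w∈X , ∈image⁺ f w∈A
    ; meetsʸ = Y∩T
    ; leaves = e , e∈X , fe∉T
    }
    where
    open MinimalEar earX renaming (circuit to cX)
    T = image f A
    e∉A : e ∉ A
    e∉A = fe∉T ∘ ∈image⁺ f
    w = proj₁ meets
    w∈X = proj₁ (proj₂ meets)
    w∈A = proj₂ (proj₂ meets)
    elim-w = elimination M cA cX (∉⇒≢ e∈X e∉A ∘ sym) w∈A w∈X
    Y = proj₁ elim-w
    cY = proj₁ (proj₂ elim-w)
    Y⊆ : Y ⊆ A ∪ X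
    Y⊆ = proj₁ (proj₂ (proj₂ elim-w))
    w∉Y : w ∉ Y
    w∉Y = proj₂ (proj₂ (proj₂ elim-w))
    X∖A⊆Y : ∀ {s} → s ∈ X → s ∉ A → s ∈ Y
    X∖A⊆Y with circuit-∖ M cY cA w∈A w∉Y
    ... | x , x∈Y , x∉A = minimal cY Y⊆ x∈Y x∉A
    A⊆X∪Y : A ⊆ X ∪ Y
    -- Without `e` the new circuit has no room for the whole ear, so by minimality it lies in `A`
    -- and therefore equals `A`.
    A⊆X∪Y with elimination M cX cY (∉⇒≢ w∈X w∉Y) e∈X (X∖A⊆Y e∈X e∉A)
    ... | G , cG , G⊆ , e∉G = subst (_⊆ X ∪ Y) (C2 M cG cA G⊆A) G⊆
      where
      G⊆A : G ⊆ A
      G⊆A {g} g∈G = decidable-stable (g ∈? A) λ g∉A →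
        e∉G (minimal cG (∪-lub (x∈p∪q⁺ ∘ inj₂) Y⊆ ∘ G⊆) g∈G g∉A e∈X e∉A)
    X─Y⊆T : ∀ {y} → y ∈ image f X → y ∉ image f Y → y ∈ T
    X─Y⊆T y∈ y∉ with ∈image⁻ f y∈
    ... | x , x∈X , refl = ∈image⁺ f (decidable-stable (x ∈? A) λ x∉A → y∉ (∈image⁺ f (X∖A⊆Y x∈X x∉A)))
    Y─X⊆T : ∀ {y} → y ∈ image f Y → y ∉ image f X → y ∈ T
    Y─X⊆T y∈ y∉ with ∈image⁻ f y∈
    ... | x , x∈Y , refl = ∈image⁺ f (decidable-stable (x ∈? A) λ x∉A → y∉ (∈image⁺ f (∈∪∖ˡ (Y⊆ x∈Y) x∉A)))
    fX≢fY : image f X ≢ image f Y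
    -- Equal images would give `T ⊆ image f X` through the cover of `A`, hence equality of these
    -- circuits, although `f e` lies outside `T`.
    fX≢fY eq = fe∉T (subst (f e ∈_) (sym (image≡ cA (hom X cX) A→fX)) (∈image⁺ f e∈X))
      where
      A→fX : ∀ {x} → x ∈ A → f x ∈ image f X
      A→fX x∈A = [ ∈image⁺ f , subst (_ ∈_) (sym eq) ∘ ∈image⁺ f ]′ (x∈p∪q⁻ X Y (A⊆X∪Y x∈A))
    not-both : ∀ {y} → y ∈ T → y ∈ image f X → y ∉ image f Y
    not-both y∈T y∈fX y∈fY with binary-△-⊆ N binary (hom X cX) (hom Y cY) (hom A cA) X─Y⊆T Y─X⊆T
    ... | inj₁ eq = fX≢fY eq
    ... | inj₂ one with one y∈T
    ... | inj₁ (_ , y∉fY) = y∉fY y∈fY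
    ... | inj₂ (y∉fX , _) = y∉fX y∈fX
    inˣ : ∀ {s} → s ∈ X → f s ∈ T → s ∈ A
    -- A point of `X` outside `A` belongs to `Y` too, so its image would lie in both images.
    inˣ {s} s∈X fs∈T = decidable-stable (s ∈? A) λ s∉A →
      not-both fs∈T (∈image⁺ f s∈X) (∈image⁺ f (X∖A⊆Y s∈X s∉A))
    Y∩T : ∃[ y ] (y ∈ Y × f y ∈ T)
    Y∩T with circuit-∖ M cY cX w∈X w∉Y
    ... | y , y∈Y , y∉X = y , y∈Y , ∈image⁺ f (decidable-stable (y ∈? A) λ y∉A → y∉X (∈∪∖ˡ (Y⊆ y∈Y) y∉A))

  -- The last component keeps the ear, as far as it is mapped outside `T`, within `D`; the descent
  -- and the comparison of ears over two circuits depend on it.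
  theta-through : ∀ {T A D e} → Circuit M A → image f A ≡ T → Circuit M D →
                  ∃[ x ] (x ∈ D × x ∈ A) → e ∈ D → f e ∉ T →
                  ¬ ¬ (∃[ X ] ∃[ Y ] (Theta T A X Y × (∀ {x} → x ∈ X → f x ∉ T → x ∈ D)))
  theta-through cA refl cD D∩A e∈D fe∉T k =
    minimalEar M (⊂-wellFounded ⊤) (λ _ _ → ∈⊤) cD D∩A e∈D (fe∉T ∘ ∈image⁺ f)
      λ (X , earX , e∈X , X⊆) → let (Y , θ) = minimalEar⇒theta cA earX e∈X fe∉T in
        k (X , Y , θ , λ x∈X fx∉T → ∈∪∖ˡ (X⊆ x∈X) (fx∉T ∘ ∈image⁺ f))

  -- `R` bounds the part of `D` that is mapped outside `T`; passing to `R - t` is the descent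
  -- towards a minimal such part.
  Leaving : Subset (size N) → Subset (size M) → Subset (size M) → Set
  Leaving T R D = (∃[ e ] (e ∈ D × f e ∉ T)) × (∀ {x} → x ∈ D → f x ∉ T → x ∈ R)

  -- Thetas over two circuits with a common ear

  module _ {T A B R} (cT : Circuit N T) (A⊆T : ∀ {x} → x ∈ A → f x ∈ T)
           (irreducible : ∀ {D t} → t ∈ R → Circuit M D → ∃[ x ] (x ∈ D × x ∈ A ∪ B) → ¬ Leaving T (R - t) D)
    where

    -- If X and V, with the same ear, differed, eliminating a common element of
    -- the ear would leave a circuit with a smaller ear.
    matching-strands : ∀ {X Y V W} → (∀ {x} → x ∈ X → f x ∉ T → x ∈ R) →
                       Theta T A X Y → Theta T B V W → (∀ {x} → f x ∉ T → x ∈ X ⇔ x ∈ V) →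
                       (∀ {x y} → x ∈ V → y ∈ Y → f x ∈ T → f x ≢ f y) → X ⊆ V
    matching-strands {X} {Y} {V} X⊆R θ η same V≢Y {x} x∈X = decidable-stable (x ∈? V) x∉V⇒⊥
      where
      e = proj₁ (leaves θ)
      e∈X = proj₁ (proj₂ (leaves θ))
      fe∉T = proj₂ (proj₂ (leaves θ))
      x∉V⇒⊥ : ¬ (x ∉ V)
      x∉V⇒⊥ x∉V with elimination M (circuitˣ θ) (circuitˣ η) (∉⇒≢ x∈X x∉V) e∈X (to (same fe∉T) e∈X)
      ... | F , cF , F⊆ , e∉F = irreducible (X⊆R e∈X fe∉T) cF F∩AB (F-leaves , F⊆R)
        where
        F∖T⊆X : ∀ {z} → z ∈ F → f z ∉ T → z ∈ X
        F∖T⊆X z∈F fz∉T = [ (λ z∈X → z∈X) , from (same fz∉T) ]′ (x∈p∪q⁻ X V (F⊆ z∈F))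
        F⊆R : ∀ {z} → z ∈ F → f z ∉ T → z ∈ R - e
        F⊆R z∈F fz∉T = x∈p∧x≢y⇒x∈p-y (X⊆R (F∖T⊆X z∈F fz∉T) fz∉T) λ { refl → e∉F z∈F }
        F-leaves : ∃[ z ] (z ∈ F × f z ∉ T)
        F-leaves with any? (λ z → (z ∈? F) ×-dec ¬? (f z ∈? T))
        ... | yes p = p
        -- If `F` stayed over `T`, its image would be `T`; but neither `X` nor `V` has a point over
        -- `T` with the image of `y`.
        ... | no ¬p = contradiction (∈image⁻ f fy∈fF) clash
          where
          y = proj₁ (meetsʸ θ)
          y∈Y = proj₁ (proj₂ (meetsʸ θ))
          fy∈T = proj₂ (proj₂ (meetsʸ θ))
          F⊆T : ∀ {z} → z ∈ F → f z ∈ T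
          F⊆T {z} z∈F = decidable-stable (f z ∈? T) λ fz∉T → ¬p (z , z∈F , fz∉T)
          fy∈fF : f y ∈ image f F
          fy∈fF = subst (f y ∈_) (sym (image≡ cF cT F⊆T)) fy∈T
          clash : ¬ (∃[ z ] (z ∈ F × f z ≡ f y))
          clash (z , z∈F , fz≡fy) =
            [ (λ z∈X → separated θ z∈X y∈Y (F⊆T z∈F) fz≡fy)
            , (λ z∈V → V≢Y z∈V y∈Y (F⊆T z∈F) fz≡fy) ]′ (x∈p∪q⁻ X V (F⊆ z∈F))
        F∩AB : ∃[ z ] (z ∈ F × z ∈ A ∪ B)
        -- A point of `F` outside `X` lies in `V`; since the ears coincide it is mapped into `T`,
        -- hence lies in `B`.
        F∩AB with circuit-∖ M cF (circuitˣ θ) e∈X e∉F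
        ... | z , z∈F , z∉X = z , z∈F , x∈p∪q⁺ (inj₂ (insideˣ η z∈V fz∈T))
          where
          fz∈T : f z ∈ T
          fz∈T = decidable-stable (f z ∈? T) λ fz∉T → z∉X (F∖T⊆X z∈F fz∉T)
          z∈V : z ∈ V
          z∈V = ∈∪∖ˡ (F⊆ z∈F) z∉X

    -- The separation hypotheses pair `X` with `V` and `Y` with `W`. Matching both pairs gives
    -- `X ⊆ V` and `Y ⊆ W`, and `X` and `Y` cover `A`.
    compatible-thetas : ∀ {X Y V W} → (∀ {x} → x ∈ X → f x ∉ T → x ∈ R) →
                        Theta T A X Y → Theta T B V W → (∀ {x} → f x ∉ T → x ∈ X ⇔ x ∈ V) →
                        (∀ {x y} → x ∈ V → y ∈ Y → f x ∈ T → f x ≢ f y) →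
                        (∀ {x y} → x ∈ W → y ∈ X → f x ∈ T → f x ≢ f y) → A ⊆ B
    compatible-thetas X⊆R θ η same V≢Y W≢X x∈A with x∈p∪q⁻ _ _ (cover θ x∈A)
    ... | inj₁ x∈X = insideˣ η (matching-strands X⊆R θ η same V≢Y x∈X) (A⊆T x∈A)
    ... | inj₂ x∈Y = insideʸ η (matching-strands Y⊆R (Theta-swap θ) (Theta-swap η) same′ W≢X x∈Y) (A⊆T x∈A)
      where
      Y⊆R : ∀ {x} → x ∈ _ → f x ∉ T → x ∈ R
      Y⊆R x∈Y fx∉T = X⊆R (from (ear θ fx∉T) x∈Y) fx∉T
      same′ : ∀ {x} → f x ∉ T → x ∈ _ ⇔ x ∈ _
      same′ fx∉T = mk⇔ (to (ear η fx∉T) ∘ to (same fx∉T) ∘ from (ear θ fx∉T))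
                       (to (ear θ fx∉T) ∘ from (same fx∉T) ∘ from (ear η fx∉T))

    -- With the same ear, the images of `X` and `V` differ only within `T`, so they are equal or
    -- complementary on `T`. In the first case `X` is paired with `V`, in the second with `W`.
    common-ear⇒⊆ : ∀ {X Y V W} → (∀ {x} → x ∈ X → f x ∉ T → x ∈ R) →
                   Theta T A X Y → Theta T B V W → (∀ {x} → f x ∉ T → x ∈ X ⇔ x ∈ V) → A ⊆ B
    common-ear⇒⊆ {X} {Y} {V} {W} X⊆R θ η same =
      [ equal , opposite ]′ (binary-△-⊆ N binary (hom X (circuitˣ θ)) (hom V (circuitˣ η)) cT X─V⊆T V─X⊆T)
      where
      X─V⊆T : ∀ {y} → y ∈ image f X → y ∉ image f V → y ∈ T
      X─V⊆T y∈ y∉ with ∈image⁻ f y∈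
      ... | x , x∈X , refl = decidable-stable (f x ∈? T) λ fx∉T → y∉ (∈image⁺ f (to (same fx∉T) x∈X))

      V─X⊆T : ∀ {y} → y ∈ image f V → y ∉ image f X → y ∈ T
      V─X⊆T y∈ y∉ with ∈image⁻ f y∈
      ... | x , x∈V , refl = decidable-stable (f x ∈? T) λ fx∉T → y∉ (∈image⁺ f (from (same fx∉T) x∈V))

      equal : image f X ≡ image f V → A ⊆ B
      equal fX≡fV = compatible-thetas X⊆R θ η same
        (λ x∈V y∈Y fx∈T fx≡fy → separated-image θ y∈Y (subst (_∈ T) fx≡fy fx∈T)
          (subst (_ ∈_) (sym fX≡fV) (subst (_∈ image f V) fx≡fy (∈image⁺ f x∈V))))
        (λ x∈W y∈X fx∈T fx≡fy → separated-image η x∈W fx∈T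
          (subst (_ ∈_) fX≡fV (subst (_∈ image f X) (sym fx≡fy) (∈image⁺ f y∈X))))

      opposite : (∀ {y} → y ∈ T → (y ∈ image f X × y ∉ image f V) ⊎ (y ∉ image f X × y ∈ image f V)) → A ⊆ B
      opposite one = compatible-thetas X⊆R θ (Theta-swap η)
        (λ fx∉T → mk⇔ (to (ear η fx∉T) ∘ to (same fx∉T)) (from (same fx∉T) ∘ from (ear η fx∉T)))
        (λ x∈W y∈Y fx∈T fx≡fy →
          [ (λ (fx∈fX , _) → separated-image θ y∈Y (subst (_∈ T) fx≡fy fx∈T) (subst (_∈ image f X) fx≡fy fx∈fX))
          , (λ (_ , fx∈fV) → separated-image η x∈W fx∈T fx∈fV) ]′ (one fx∈T))
        (λ x∈V y∈X fx∈T fx≡fy →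
          [ (λ (_ , fx∉fV) → fx∉fV (∈image⁺ f x∈V))
          , (λ (fx∉fX , _) → fx∉fX (subst (_∈ image f X) (sym fx≡fy) (∈image⁺ f y∈X))) ]′ (one fx∈T))

  -- Descent on `R`. A theta over `A` with ear from `D` has a strand through `g`; this strand meets
  -- `B`, so it yields a theta over `B` whose ear is part of the first. A strictly smaller ear would
  -- continue the descent, so the ears coincide and `A ⊆ B`, forcing `A ≡ B`.
  common-image⇒¬leaving : ∀ {T A B D R g} → Acc _⊂_ R → Circuit N T →
                 Circuit M A → Circuit M B → image f A ≡ T → image f B ≡ T → g ∈ A → g ∈ B → A ≢ B →
                 Circuit M D → ∃[ x ] (x ∈ D × x ∈ A) → ¬ Leaving T R D
  common-image⇒¬leaving {T} {A} {B} {D} {R} {g} (acc rec) cT cA cB fA≡T fB≡T g∈A g∈B A≢B cD D∩A ((_ , e∈D , fe∉T) , D⊆R) =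
    theta-through cA fA≡T cD D∩A e∈D fe∉T λ (X , Y , θ , X⊆D) →
      [ step θ (λ x∈X fx∉T → D⊆R (X⊆D x∈X fx∉T) fx∉T)
      , step (Theta-swap θ) (λ x∈Y fx∉T → D⊆R (X⊆D (from (ear θ fx∉T) x∈Y) fx∉T) fx∉T)
      ]′ (x∈p∪q⁻ X Y (cover θ g∈A))
    where
    irreducible : ∀ {D t} → t ∈ R → Circuit M D → ∃[ x ] (x ∈ D × x ∈ A ∪ B) → ¬ Leaving T (R - t) D
    -- A circuit that meets `B` is handled by exchanging `A` and `B`, in which the hypotheses are
    -- symmetric.
    irreducible t∈R cD (x , x∈D , x∈A∪B) = [
      (λ x∈A → common-image⇒¬leaving (rec (x∈p⇒p-x⊂p t∈R)) cT cA cB fA≡T fB≡T g∈A g∈B A≢B cD (x , x∈D , x∈A)) ,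
      (λ x∈B → common-image⇒¬leaving (rec (x∈p⇒p-x⊂p t∈R)) cT cB cA fB≡T fA≡T g∈B g∈A (A≢B ∘ sym) cD (x , x∈D , x∈B))
      ]′ (x∈p∪q⁻ A B x∈A∪B)

    step : ∀ {X Y} → Theta T A X Y → (∀ {x} → x ∈ X → f x ∉ T → x ∈ R) → ¬ (g ∈ X)
    step {X} θ X⊆R g∈X with leaves θ
    ... | e , e∈X , fe∉T = theta-through cB fB≡T (circuitˣ θ) (g , g∈X , g∈B) e∈X fe∉T
      λ (V , W , η , V⊆X) → A≢B (C2 M cA cB (common-ear⇒⊆ cT (λ x∈A → subst (_ ∈_) fA≡T (∈image⁺ f x∈A)) irreducible
        X⊆R θ η λ {x} fx∉T → mk⇔ (λ x∈X → same η V⊆X x∈X fx∉T) (λ x∈V → V⊆X x∈V fx∉T)))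
      where
      same : ∀ {V W x} → Theta T B V W → (∀ {x} → x ∈ V → f x ∉ T → x ∈ X) → x ∈ X → f x ∉ T → x ∈ V
      same {V} {x = x} η V⊆X x∈X fx∉T = decidable-stable (x ∈? V) λ x∉V →
        let (v , v∈V , fv∈T) = meetsˣ η in
        irreducible (X⊆R x∈X fx∉T) (circuitˣ η) (v , v∈V , x∈p∪q⁺ (inj₂ (insideˣ η v∈V fv∈T)))
          (leaves η , λ z∈V fz∉T → x∈p∧x≢y⇒x∈p-y (X⊆R (V⊆X z∈V fz∉T) fz∉T) λ { refl → x∉V z∈V })

-- The dichotomy

theorem1 : ∀ {ℓ ℓ'} (M : Matroid ℓ) (N : Matroid ℓ') (f : E M → E N) →
    Connected M → Binary N → IsHom M N f →
    (∀ (x : E N) → IsSeriesClass M (preimage f x)) ⊎ Circuit N ⊤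
theorem1 M N f connected binary (surjective , hom) with binary⇒circuit? N binary ⊤
... | yes c⊤ = inj₂ c⊤
... | no ¬c⊤ = inj₁ series
  where
  series : ∀ x → IsSeriesClass M (preimage f x)
  -- Membership in `A` is decidable, so a contradiction suffices; this admits the doubly negated
  -- existence of minimal ears.
  series x a b A a∈ b∈ cA a∈A = decidable-stable (b ∈? A) contra
    where
    fb∈T : f b ∈ image f A
    fb∈T = subst (_∈ image f A) (trans (∈preimage⁻ f a∈) (sym (∈preimage⁻ f b∈))) (∈image⁺ f a∈A)

    contra : ¬ (b ∉ A)
    -- As `N` is not a circuit, `image f A` misses some `y`; the circuit `D` through `a` and a
    -- preimage of `y` then leaves the part of `M` over `image f A`.
    contra b∉A with connected a b (λ { refl → b∉A a∈A })
                  | ⊈⇒∃∉ {p = ⊤} {image f A} (λ ⊤⊆T → ¬c⊤ (subst (Circuit N) (⊆-antisym ⊆⊤ ⊤⊆T) (hom A cA)))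
    ... | C , cC , a∈C , b∈C | y , _ , y∉T with surjective y
    ... | e , f⟨e⟩≡y with connected e a (λ { refl → y∉T (subst (_∈ image f A) (f⟨e⟩≡y refl) (∈image⁺ f a∈A)) })
    ... | D , cD , e∈D , a∈D =
      minimalEar M (⊂-wellFounded ⊤) (λ _ _ → ∈⊤) cC (a , a∈C , a∈A) b∈C b∉A λ (B , earB , b∈B , _) →
        let open MinimalEar earB
            (g , g∈B , g∈A) = meets
            -- A point of `B` mapped outside would make `B` a strand of a theta over `A`, and
            -- `insideˣ` would put `b` into `A`.
            B⊆T : ∀ {s} → s ∈ B → f s ∈ image f A
            B⊆T {s} s∈B = decidable-stable (f s ∈? image f A) λ fs∉T →
              b∉A (Theta.insideˣ (proj₂ (minimalEar⇒theta M N f binary hom cA earB s∈B fs∉T)) b∈B fb∈T)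
        in common-image⇒¬leaving M N f binary hom (⊂-wellFounded ⊤) (hom A cA) cA circuit refl
             (image≡ M N f binary hom circuit (hom A cA) B⊆T) g∈A g∈B (∉⇒≢ b∈B b∉A ∘ sym) cD (a , a∈D , a∈A)
             ((e , e∈D , λ fe∈T → y∉T (subst (_∈ image f A) (f⟨e⟩≡y refl) fe∈T)) , λ _ _ → ∈⊤)
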